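{- Let $A$ be a bounded distributive lattice, $X$ its Priestley space, and $\kappa$ a regular cardinal. Then $A$ is a $\kappa$-frame if and only if ${\sf cl}(U)$ is a clopen upset for each $\kappa$-clopen upset $U$ of $X$.
   Context: $A$ is a $\kappa$-frame if every subset of cardinality $<\kappa$ has a join and each such join $\bigvee S$ is distributive ($a\wedge\bigvee S=\bigvee\{a\wedge s:s\in S\}$ for all $a$). The Priestley space $X$ of $A$ is the set of prime filters ordered by inclusion, with topology generated by $\{\mathfrak s(a)\setminus\mathfrak s(b)\}$, $\mathfrak s(a)=\{x:a\in x\}$. ${\sf cl}$ is topological closure. A $\kappa$-clopen upset is a union of fewer than $\kappa$ clopen upsets. -}

module Defs where

open import Axiom.ExcludedMiddle using (ExcludedMiddle) public
open import Data.List.Base using (List)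
open import Data.List.Relation.Unary.All using (All)
open import Data.Nat.Base using (ℕ)
open import Data.Product using (Σ; Σ-syntax; ∃; _×_; _,_; proj₁; proj₂)
open import Data.Sum.Base using (_⊎_)
open import Function.Bundles using (Func; Injection; Surjection; _↣_)
open import Level using (Level; _⊔_; suc)
open import Relation.Binary.Bundles using (Setoid)
open import Relation.Binary.Core using (Rel)
open import Relation.Binary.Definitions using (_Respects_)
open import Algebra.Core using (Op₂)
open import Algebra.Definitions using (_DistributesOverˡ_)
open import Relation.Binary.Lattice.Bundles using (BoundedLattice)
open import Relation.Binary.Lattice.Structures using (IsBoundedLattice)
import Relation.Binary.Construct.On as On
import Relation.Binary.PropositionalEquality.Properties as ≡
open import Relation.Nullary.Negation.Core using (¬_)
open import Relation.Unary using (Pred; _∈_; _∉_; _⊆_; _≐_; _∖_; _≬_; ∁; Universal)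
open import Relation.Unary.Relation.Binary.Equality using (≐-setoid)

------------------------------------------------------------------------
-- The classical background

-- Sets are setoids here, so that this is the usual axiom of choice in the
-- form "every surjection has a section"; it is not provable in Agda, because
-- the section must respect the equalities.

AxiomOfChoice : ∀ a b c d → Set (suc (a ⊔ b ⊔ c ⊔ d))
AxiomOfChoice a b c d =
  (S : Setoid a b) (T : Setoid c d) (f : Surjection S T) →
  Σ[ g ∈ Func T S ] ∀ y → Setoid._≈_ T (Surjection.to f (Func.to g y)) y

------------------------------------------------------------------------
-- Cardinality

infix 4 _≺_

_≺_ : ∀ {a b c d} → Setoid a b → Setoid c d → Set (a ⊔ b ⊔ c ⊔ d)
S ≺ T = Injection S T × ¬ Injection T S

-- Elements of a subset are compared in the ambient setoid; membership proofs
-- do not count towards the cardinality.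

subset : ∀ {a b p} (S : Setoid a b) → Pred (Setoid.Carrier S) p →
         Setoid (a ⊔ p) b
subset S P = On.setoid {B = Σ (Setoid.Carrier S) P} S proj₁

-- The union of a set of subsets (the stdlib ⋃ is the union of a family).

⋃ˢ : ∀ {a ℓ p} {A : Set a} → Pred (Pred A ℓ) p → Pred A (a ⊔ suc ℓ ⊔ p)
⋃ˢ 𝒰 x = ∃ λ V → V ∈ 𝒰 × x ∈ V

-- A cardinal is given by a set K of that cardinality.  It is regular if it is
-- infinite and K is not the union of fewer than |K| subsets, each having
-- fewer than |K| elements.

record IsRegularCardinal {k} (K : Set k) : Set (suc (suc k)) where
  field
    infinite    : ℕ ↣ K
    notSmallSup : (𝒮 : Pred (Pred K k) (suc k)) → 𝒮 Respects _≐_ →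
                  subset (≐-setoid K k) 𝒮 ≺ ≡.setoid K →
                  (∀ P → P ∈ 𝒮 → subset (≡.setoid K) P ≺ ≡.setoid K) →
                  ¬ Universal (⋃ˢ 𝒮)

------------------------------------------------------------------------
-- Topology generated by a subbasis

module GeneratedTopology {i x ℓ} {I : Set i} {X : Set x} (B : I → Pred X ℓ) where

  -- The list is's finite intersection of subbasic sets is a neighbourhood
  -- contained in W; the empty list gives the whole space.

  IsOpen : ∀ {w} → Pred X w → Set (i ⊔ x ⊔ ℓ ⊔ w)
  IsOpen W = ∀ {x} → x ∈ W → Σ[ is ∈ List I ]
    All (λ i → x ∈ B i) is × (∀ y → All (λ i → y ∈ B i) is → y ∈ W)

  IsClosed : ∀ {w} → Pred X w → Set (i ⊔ x ⊔ ℓ ⊔ w)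
  IsClosed W = IsOpen (∁ W)

  IsClopen : ∀ {w} → Pred X w → Set (i ⊔ x ⊔ ℓ ⊔ w)
  IsClopen W = IsOpen W × IsClosed W

  -- Quantifying over the open sets at level ℓ loses nothing: it includes the
  -- finite intersections of subbasic sets.

  cl : ∀ {u} → Pred X u → Pred X (i ⊔ x ⊔ suc ℓ ⊔ u)
  cl U x = (W : Pred X ℓ) → IsOpen W → x ∈ W → W ≬ U

------------------------------------------------------------------------
-- Bounded distributive lattices

record BoundedDistributiveLattice c ℓ₁ ℓ₂ : Set (suc (c ⊔ ℓ₁ ⊔ ℓ₂)) where
  infix  4 _≈_ _≤_
  infixr 6 _∨_
  infixr 7 _∧_
  field
    Carrier          : Set c
    _≈_              : Rel Carrier ℓ₁
    _≤_              : Rel Carrier ℓ₂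
    _∨_              : Op₂ Carrier
    _∧_              : Op₂ Carrier
    ⊤                : Carrier
    ⊥                : Carrier
    isBoundedLattice : IsBoundedLattice _≈_ _≤_ _∨_ _∧_ ⊤ ⊥
    ∧-distribˡ-∨     : _DistributesOverˡ_ _≈_ _∧_ _∨_

  boundedLattice : BoundedLattice c ℓ₁ ℓ₂
  boundedLattice = record { isBoundedLattice = isBoundedLattice }

  open BoundedLattice boundedLattice public
    hiding (Carrier; _≈_; _≤_; _∨_; _∧_; ⊤; ⊥; isBoundedLattice)

module _ {c ℓ₁ ℓ₂} (A : BoundedDistributiveLattice c ℓ₁ ℓ₂) where

  open BoundedDistributiveLattice A

  private
    ℓ : Level
    ℓ = c ⊔ ℓ₁ ⊔ ℓ₂

  ----------------------------------------------------------------------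
  -- κ-frames

  record IsJoin {p} (S : Pred Carrier p) (j : Carrier) : Set (c ⊔ ℓ₂ ⊔ p) where
    field
      upper : ∀ {s} → s ∈ S → s ≤ j
      least : ∀ {b} → (∀ {s} → s ∈ S → s ≤ b) → j ≤ b

  infix 8 _∧ˢ_

  _∧ˢ_ : ∀ {p} → Carrier → Pred Carrier p → Pred Carrier (c ⊔ ℓ₁ ⊔ p)
  (a ∧ˢ S) b = ∃ λ s → s ∈ S × b ≈ a ∧ s

  IsκFrame : ∀ {k} → Set k → Set (suc ℓ ⊔ k)
  IsκFrame K = (S : Pred Carrier ℓ) → S Respects _≈_ →
    subset setoid S ≺ ≡.setoid K →
    ∃ λ j → IsJoin S j × (∀ a → IsJoin (a ∧ˢ S) (a ∧ j))

  ----------------------------------------------------------------------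
  -- The Priestley space

  record PrimeFilter : Set (suc ℓ) where
    field
      filter   : Pred Carrier ℓ
      upward   : ∀ {a b} → a ∈ filter → a ≤ b → b ∈ filter
      ⊤∈       : ⊤ ∈ filter
      ∧-closed : ∀ {a b} → a ∈ filter → b ∈ filter → a ∧ b ∈ filter
      ⊥∉       : ⊥ ∉ filter
      prime    : ∀ {a b} → a ∨ b ∈ filter → a ∈ filter ⊎ b ∈ filter

  open PrimeFilter

  𝔰 : Carrier → Pred PrimeFilter ℓ
  𝔰 a x = a ∈ filter x

  -- Prime filters with the same elements count as the same point.  No
  -- quotient is needed, since open sets and upsets cannot separate them.

  open GeneratedTopology {I = Carrier × Carrier} (λ (a , b) → 𝔰 a ∖ 𝔰 b) public

  IsUpset : ∀ {w} → Pred PrimeFilter w → Set (suc ℓ ⊔ w)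
  IsUpset W = ∀ {x y} → filter x ⊆ filter y → x ∈ W → y ∈ W

  IsClopenUpset : ∀ {w} → Pred PrimeFilter w → Set (suc ℓ ⊔ w)
  IsClopenUpset W = IsClopen W × IsUpset W

  IsκClopenUpset : ∀ {k} → Set k → Pred PrimeFilter (suc ℓ) →
                   Set (suc (suc ℓ) ⊔ k)
  IsκClopenUpset K U = Σ[ 𝒰 ∈ Pred (Pred PrimeFilter ℓ) (suc ℓ) ]
    𝒰 Respects _≐_ ×
    subset (≐-setoid PrimeFilter ℓ) 𝒰 ≺ ≡.setoid K ×
    (∀ V → V ∈ 𝒰 → IsClopenUpset V) ×
    U ≐ ⋃ˢ 𝒰

{-# OPTIONS --safe #-}
module Submission where

-- By the prime filter theorem 𝔰 is an order embedding of A into the clopen upsets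
-- of X, and by compactness every clopen upset is some 𝔰 a.  A κ-clopen upset is
-- therefore a union U of the 𝔰 s for s in a set S with fewer than κ elements, and
-- cl U = 𝔰 j holds precisely when j is a distributive join of S: a basic open set
-- 𝔰 a ∖ 𝔰 b misses U iff a ∧ s ≤ b for all s in S, and misses 𝔰 j iff a ∧ j ≤ b.
--
-- Compactness is not proved separately.  A filter x that is maximal among those
-- avoiding an ideal I is prime and has for every a ∉ x some g ∈ x with g ∧ a ∈ I;
-- applied to I = {a : 𝔰 a ⊆ V}, and dually to {a : V ⊆ 𝔰 a}, this represents V.

open import Defs
open import Algebra.Core using (Op₂)
open import Axiom.DoubleNegationElimination using (em⇒dne)
open import Data.Empty using (⊥-elim)
open import Data.List.Base using (List; []; _∷_)
open import Data.List.Relation.Unary.All using (All; []; _∷_)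
open import Data.Product using (Σ; ∃; ∃₂; _×_; _,_; proj₁; proj₂)
open import Data.Product.Relation.Binary.Pointwise.NonDependent using (_×ₛ_)
open import Data.Sum.Base using (_⊎_; inj₁; inj₂; [_,_]′)
import Data.Sum.Base as Sum
open import Function.Base using (id; _∘_; flip; case_of_)
open import Function.Bundles using (_⇔_; mk⇔; Equivalence; Func; Injection)
import Function.Construct.Composition as Composition
open import Level using (Lift; lift; lower; _⊔_; suc)
open import Relation.Binary.Bundles using (Setoid)
import Relation.Binary.Construct.On as On
open import Relation.Binary.Core using (Rel)
open import Relation.Binary.Definitions using (_Respects_)
import Relation.Binary.Lattice.Properties.DistributiveLattice as DistributiveLatticeProperties
import Relation.Binary.Lattice.Properties.JoinSemilattice as JoinSemilatticeProperties
import Relation.Binary.Lattice.Properties.Lattice as LatticeProperties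
import Relation.Binary.Lattice.Properties.MeetSemilattice as MeetSemilatticeProperties
open import Relation.Nullary.Decidable.Core using (True; toWitness; fromWitness; yes; no)
open import Relation.Nullary.Negation.Core using (¬_)
open import Relation.Unary
  using (Pred; _∈_; _∉_; _⊆_; _≐_; _∖_; _≬_; ∁; Satisfiable)
open import Relation.Unary.Properties using (≐-sym; ≐-trans)
open import Relation.Unary.Relation.Binary.Equality using (≐-setoid)

-- Chains and comparison of cardinalities.

IsChain : ∀ {c ℓ p} {C : Set c} → Pred (Pred C ℓ) p → Set (c ⊔ suc ℓ ⊔ p)
IsChain 𝒞 = ∀ {F G} → F ∈ 𝒞 → G ∈ 𝒞 → F ⊆ G ⊎ G ⊆ F

≺-trans-injection : ∀ {a b c d e f} {R : Setoid a b} {S : Setoid c d} {T : Setoid e f} →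
                    Injection R S → S ≺ T → R ≺ T
≺-trans-injection R↣S (S↣T , T↣̸S) =
  Composition.injection R↣S S↣T , λ T↣R → T↣̸S (Composition.injection T↣R R↣S)

module _ (em : ∀ {ℓ} → ExcludedMiddle ℓ) where

  dne : ∀ {p} {P : Set p} → ¬ ¬ P → P
  dne = em⇒dne em

  -- Excluded middle lets a predicate be moved to any universe level.
  resized : ∀ {c p q} {C : Set c} → Pred C p → Pred C q
  resized {q = q} P x = Lift q (True (em {P = P x}))

  resized⁺ : ∀ {c p q} {C : Set c} (P : Pred C p) → P ⊆ resized {q = q} P
  resized⁺ P = lift ∘ fromWitness

  resized⁻ : ∀ {c p q} {C : Set c} (P : Pred C p) → resized {q = q} P ⊆ P
  resized⁻ P = toWitness ∘ lower

  -- Zorn's lemma for predicates ordered by inclusion.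

  module _ (ac : ∀ {a b c d} → AxiomOfChoice a b c d)
           {c ℓ q} {C : Set c} (Q : Pred (Pred C ℓ) q)
           -- `⋃ˢ 𝒞` lives in a higher universe than the members of `𝒞`, so any `M` of level `ℓ`
           -- with the same elements stands in for it.
           (Q-chain : ∀ (𝒞 : Pred (Pred C ℓ) ℓ) → 𝒞 ⊆ Q → Satisfiable 𝒞 → IsChain 𝒞 →
                      ∀ M → M ≐ ⋃ˢ 𝒞 → M ∈ Q)
           (F₀ : Pred C ℓ) (F₀∈Q : F₀ ∈ Q) where

    Extension : Pred C ℓ → Set (c ⊔ suc ℓ ⊔ q)
    Extension F = ∃ λ G → G ∈ Q × F ⊆ G × ¬ (G ⊆ F)

    Extendable : Setoid _ _
    Extendable = subset (≐-setoid C ℓ) Extension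

    -- Forgetting the extension, from pairs compared in both components to sets alone, is a
    -- surjection. Its section selects extensions in a way that respects `≐`, but for some `F′ ≐ F`
    -- rather than for `F` itself.
    choice : Σ (Func Extendable _) λ g → ∀ F → proj₁ (Func.to g F) ≐ proj₁ F
    choice = ac (On.setoid (≐-setoid C ℓ ×ₛ ≐-setoid C ℓ) λ (F , G , _) → F , G) Extendable
      record { to = id ; cong = proj₁ ; surjective = λ F → F , proj₁ }

    grow : Pred C ℓ → Pred C ℓ
    grow F with em {P = Extension F}
    ... | yes e = proj₁ (proj₂ (Func.to (proj₁ choice) (F , e)))
    ... | no  _ = F

    grow-inflationary : ∀ F → F ⊆ grow F
    grow-inflationary F with em {P = Extension F}
    ... | yes e = let _ , _ , F′⊆G , _ = proj₂ (Func.to (proj₁ choice) (F , e))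
                  in F′⊆G ∘ proj₂ (proj₂ choice (F , e))
    ... | no  _ = id

    -- The section is a setoid map, which settles the case of two extendable sets; extendability is
    -- invariant under `≐`, which rules out the mixed cases.
    grow-cong : ∀ {F G} → F ≐ G → grow F ⊆ grow G
    grow-cong {F} {G} F≐G with em {P = Extension F} | em {P = Extension G}
    ... | yes _ | yes _ = proj₁ (proj₂ (Func.cong (proj₁ choice) F≐G))
    ... | yes (H , H∈Q , F⊆H , H⊈F) | no ¬e =
      ⊥-elim (¬e (H , H∈Q , F⊆H ∘ proj₂ F≐G , λ H⊆G → H⊈F (proj₂ F≐G ∘ H⊆G)))
    ... | no ¬e | yes (H , H∈Q , G⊆H , H⊈G) =
      ⊥-elim (¬e (H , H∈Q , G⊆H ∘ proj₁ F≐G , λ H⊆F → H⊈G (proj₁ F≐G ∘ H⊆F)))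
    ... | no _  | no _  = proj₁ F≐G

    grow-∈Q : ∀ {F} → F ∈ Q → grow F ∈ Q
    grow-∈Q {F} F∈Q with em {P = Extension F}
    ... | yes e = proj₁ (proj₂ (proj₂ (Func.to (proj₁ choice) (F , e))))
    ... | no  _ = F∈Q

    grow-⊆⇒maximal : ∀ {F} → grow F ⊆ F → ¬ Extension F
    grow-⊆⇒maximal {F} grow⊆F with em {P = Extension F}
    ... | yes e = let _ , _ , _ , G⊈F′ = proj₂ (Func.to (proj₁ choice) (F , e))
                  in ⊥-elim (G⊈F′ (proj₂ (proj₂ choice (F , e)) ∘ grow⊆F))
    ... | no ¬e = ¬e

    -- Zorn's lemma by way of the Bourbaki–Witt tower generated from F₀ by grow and
    -- unions of nonempty families; it is a chain because all its members are extreme.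
    data Stage : Pred C ℓ → Set (c ⊔ suc ℓ) where
      base  : Stage F₀
      next  : ∀ {F} → Stage F → Stage (grow F)
      limit : (𝒞 : Pred (Pred C ℓ) ℓ) → Satisfiable 𝒞 → 𝒞 ⊆ Stage → Stage (resized (⋃ˢ 𝒞))

    F₀⊆stage : ∀ {F} → Stage F → F₀ ⊆ F
    F₀⊆stage base = id
    F₀⊆stage (next {F} s) = grow-inflationary F ∘ F₀⊆stage s
    F₀⊆stage (limit 𝒞 (F , F∈𝒞) 𝒞⊆Stage) x∈F₀ =
      resized⁺ (⋃ˢ 𝒞) (F , F∈𝒞 , F₀⊆stage (𝒞⊆Stage F∈𝒞) x∈F₀)

    -- The extreme points of the Bourbaki-Witt argument; strict inclusion is an inclusion whose
    -- converse fails.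
    IsExtreme : Pred (Pred C ℓ) (c ⊔ suc ℓ)
    IsExtreme G = ∀ {F} → Stage F → F ⊆ G → ¬ (G ⊆ F) → grow F ⊆ G

    -- By induction on the stage `F`: if `F` is properly inside `G`, extremality keeps `grow F`
    -- inside `G`; if `F ≐ G`, then `grow G ⊆ grow F`. A union lies in `G` unless one of its members
    -- contains `grow G`.
    extreme-dichotomy : ∀ {F G} → F₀ ⊆ G → IsExtreme G → Stage F → F ⊆ G ⊎ grow G ⊆ F
    extreme-dichotomy F₀⊆G G-extreme base = inj₁ F₀⊆G
    extreme-dichotomy {G = G} F₀⊆G G-extreme (next {F} s)
      with extreme-dichotomy F₀⊆G G-extreme s
    ... | inj₂ growG⊆F = inj₂ (grow-inflationary F ∘ growG⊆F)
    ... | inj₁ F⊆G with em {P = G ⊆ F}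
    ...   | yes G⊆F = inj₂ (grow-cong (G⊆F , F⊆G))
    ...   | no  G⊈F = inj₁ (G-extreme s F⊆G G⊈F)
    extreme-dichotomy {G = G} F₀⊆G G-extreme (limit 𝒞 _ 𝒞⊆Stage)
      with em {P = ∃ λ F → F ∈ 𝒞 × grow G ⊆ F}
    ... | yes (F , F∈𝒞 , growG⊆F) = inj₂ λ x∈ → resized⁺ (⋃ˢ 𝒞) (F , F∈𝒞 , growG⊆F x∈)
    ... | no ¬above = inj₁ λ x∈ → let F , F∈𝒞 , x∈F = resized⁻ (⋃ˢ 𝒞) x∈ in
      case extreme-dichotomy F₀⊆G G-extreme (𝒞⊆Stage F∈𝒞) of λ where
        (inj₁ F⊆G)     → F⊆G x∈F
        (inj₂ growG⊆F) → ⊥-elim (¬above (F , F∈𝒞 , growG⊆F))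

    -- By induction on `G`, comparing `F` with the predecessor of `G` or, at a limit, with the
    -- members of the family.
    stage-extreme : ∀ {G} → Stage G → IsExtreme G
    stage-extreme base t _ F₀⊈F = ⊥-elim (F₀⊈F (F₀⊆stage t))
    stage-extreme (next {G} s) {F} t F⊆growG growG⊈F
      with extreme-dichotomy (F₀⊆stage s) (stage-extreme s) t
    ... | inj₂ growG⊆F = ⊥-elim (growG⊈F growG⊆F)
    ... | inj₁ F⊆G with em {P = G ⊆ F}
    ...   | yes G⊆F = grow-cong (F⊆G , G⊆F)
    ...   | no  G⊈F = grow-inflationary G ∘ stage-extreme s t F⊆G G⊈F
    stage-extreme (limit 𝒞 𝒞≢∅ 𝒞⊆Stage) {F} t F⊆⋃ ⋃⊈F
      with em {P = ∃ λ G → G ∈ 𝒞 × F ⊆ G}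
    ... | no ¬above = ⊥-elim (⋃⊈F
      (λ x∈ → let G , G∈𝒞 , x∈G = resized⁻ (⋃ˢ 𝒞) x∈ ; s = 𝒞⊆Stage G∈𝒞 in
        case extreme-dichotomy (F₀⊆stage s) (stage-extreme s) t of λ where
          (inj₁ F⊆G)     → ⊥-elim (¬above (G , G∈𝒞 , F⊆G))
          (inj₂ growG⊆F) → growG⊆F (grow-inflationary G x∈G)))
    ... | yes (G , G∈𝒞 , F⊆G) with em {P = G ⊆ F}
    ...   | no G⊈F = λ x∈ →
      resized⁺ (⋃ˢ 𝒞) (G , G∈𝒞 , stage-extreme (𝒞⊆Stage G∈𝒞) t F⊆G G⊈F x∈)
    -- Here `F ≐ G`, so `G` is compared with the whole union instead.
    ...   | yes G⊆F =
      case extreme-dichotomy (F₀⊆stage (𝒞⊆Stage G∈𝒞)) (stage-extreme (𝒞⊆Stage G∈𝒞))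
             (limit 𝒞 𝒞≢∅ 𝒞⊆Stage) of λ where
        (inj₁ ⋃⊆G)     → ⊥-elim (⋃⊈F (G⊆F ∘ ⋃⊆G))
        (inj₂ growG⊆⋃) → growG⊆⋃ ∘ grow-cong (F⊆G , G⊆F)

    stage-chain : IsChain Stage
    stage-chain {F} {G} s t =
      Sum.map₂ (λ growG⊆F x∈G → growG⊆F (grow-inflationary G x∈G))
        (extreme-dichotomy (F₀⊆stage t) (stage-extreme t) s)

    stage-∈Q : Stage ⊆ Q
    stage-∈Q base = F₀∈Q
    stage-∈Q (next s) = grow-∈Q (stage-∈Q s)
    stage-∈Q (limit 𝒞 𝒞≢∅ 𝒞⊆Stage) =
      Q-chain 𝒞 (λ F∈𝒞 → stage-∈Q (𝒞⊆Stage F∈𝒞)) 𝒞≢∅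
        (λ F∈𝒞 G∈𝒞 → stage-chain (𝒞⊆Stage F∈𝒞) (𝒞⊆Stage G∈𝒞))
        _ (resized⁻ (⋃ˢ 𝒞) , resized⁺ (⋃ˢ 𝒞))

    abstract
      -- The union of all stages is itself a stage, so it contains its own `grow` and has no proper
      -- extension in `Q`.
      zorn : ∃ λ M → M ∈ Q × F₀ ⊆ M × (∀ {G} → G ∈ Q → M ⊆ G → G ⊆ M)
      zorn = M , stage-∈Q M-stage , F₀⊆stage M-stage , λ {G} G∈Q M⊆G → dne λ G⊈M →
        grow-⊆⇒maximal (λ x∈ → resized⁺ (⋃ˢ stages) (grow M , resized⁺ Stage (next M-stage) , x∈))
          (G , G∈Q , M⊆G , G⊈M)
        where
        stages : Pred (Pred C ℓ) ℓ
        stages = resized Stage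

        M : Pred C ℓ
        M = resized (⋃ˢ stages)

        M-stage : Stage M
        M-stage = limit stages (F₀ , resized⁺ Stage base) (resized⁻ Stage)

-- Order duality, filters and ideals.

opposite : ∀ {c ℓ₁ ℓ₂} → BoundedDistributiveLattice c ℓ₁ ℓ₂ → BoundedDistributiveLattice c ℓ₁ ℓ₂
opposite A = record
  { _≤_ = flip _≤_ ; _∨_ = _∧_ ; _∧_ = _∨_ ; ⊤ = ⊥ ; ⊥ = ⊤
  ; isBoundedLattice = record
    { isLattice = LatticeProperties.∧-∨-isLattice lattice
    ; maximum   = minimum
    ; minimum   = maximum
    }
  ; ∧-distribˡ-∨ = DistributiveLatticeProperties.∨-distribˡ-∧ record
    { isDistributiveLattice = record { isLattice = isLattice ; ∧-distribˡ-∨ = ∧-distribˡ-∨ } }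
  }
  where open BoundedDistributiveLattice A

-- With the order, meet and top as parameters, an ideal is a filter for the reversed data, so
-- passing to `opposite` exchanges the two notions definitionally.
record IsFilter {c ℓ p} {C : Set c} (_≤_ : Rel C ℓ) (_∧_ : Op₂ C) (⊤ : C) (F : Pred C p) :
                Set (c ⊔ ℓ ⊔ p) where
  field
    upward   : ∀ {a b} → a ∈ F → a ≤ b → b ∈ F
    ⊤∈       : ⊤ ∈ F
    ∧-closed : ∀ {a b} → a ∈ F → b ∈ F → (a ∧ b) ∈ F

-- Prime filters from maximality.

module PrimeFilterTheorem
  (em : ∀ {ℓ} → ExcludedMiddle ℓ) (ac : ∀ {a b c d} → AxiomOfChoice a b c d)
  {c ℓ₁ ℓ₂} (A : BoundedDistributiveLattice c ℓ₁ ℓ₂) where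

  open BoundedDistributiveLattice A
  open MeetSemilatticeProperties meetSemilattice using (∧-monotonic)
  open JoinSemilatticeProperties joinSemilattice using (∨-monotonic)
  open PrimeFilter

  Filter Ideal : ∀ {p} → Pred Carrier p → Set _
  Filter = IsFilter _≤_ _∧_ ⊤
  Ideal  = IsFilter (flip _≤_) _∨_ ⊥

  primeFilter-isFilter : (x : PrimeFilter A) → Filter (filter x)
  primeFilter-isFilter x = record
    { upward = upward x ; ⊤∈ = ⊤∈ x ; ∧-closed = ∧-closed x }

  chain-⋃-isFilter : ∀ {p q} (𝒞 : Pred (Pred Carrier p) q) → (∀ {F} → F ∈ 𝒞 → Filter F) →
                     Satisfiable 𝒞 → IsChain 𝒞 → Filter (⋃ˢ 𝒞)
  chain-⋃-isFilter 𝒞 𝒞-filters (F , F∈𝒞) chain = record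
    { upward   = λ (G , G∈𝒞 , a∈G) a≤b → G , G∈𝒞 , IsFilter.upward (𝒞-filters G∈𝒞) a∈G a≤b
    ; ⊤∈       = F , F∈𝒞 , IsFilter.⊤∈ (𝒞-filters F∈𝒞)
    ; ∧-closed = λ (G , G∈𝒞 , a∈G) (H , H∈𝒞 , b∈H) → case chain G∈𝒞 H∈𝒞 of λ where
        (inj₁ G⊆H) → H , H∈𝒞 , IsFilter.∧-closed (𝒞-filters H∈𝒞) (G⊆H a∈G) b∈H
        (inj₂ H⊆G) → G , G∈𝒞 , IsFilter.∧-closed (𝒞-filters G∈𝒞) a∈G (H⊆G b∈H)
    }

  filter-resp-≐ : ∀ {p q} {F : Pred Carrier p} {G : Pred Carrier q} →
                  F ≐ G → Filter F → Filter G
  filter-resp-≐ (F⊆G , G⊆F) F-filter = record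
    { upward   = λ a∈G a≤b → F⊆G (F.upward (G⊆F a∈G) a≤b)
    ; ⊤∈       = F⊆G F.⊤∈
    ; ∧-closed = λ a∈G b∈G → F⊆G (F.∧-closed (G⊆F a∈G) (G⊆F b∈G))
    }
    where module F = IsFilter F-filter

  resized-isFilter : ∀ {p q} {F : Pred Carrier p} → Filter F → Filter (resized em {q = q} F)
  resized-isFilter {F = F} = filter-resp-≐ (resized⁺ em F , resized⁻ em F)

  -- For a filter `F`, the filter generated by `F` and `a`.
  adjoin : ∀ {p} → Pred Carrier p → Carrier → Pred Carrier (c ⊔ ℓ₂ ⊔ p)
  adjoin F a b = ∃ λ f → f ∈ F × f ∧ a ≤ b

  adjoin-isFilter : ∀ {p} {F : Pred Carrier p} → Filter F → ∀ a → Filter (adjoin F a)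
  adjoin-isFilter F-filter a = record
    { upward   = λ (f , f∈F , f∧a≤b) b≤d → f , f∈F , trans f∧a≤b b≤d
    ; ⊤∈       = ⊤ , F.⊤∈ , maximum _
    ; ∧-closed = λ (f , f∈F , f∧a≤b) (g , g∈F , g∧a≤d) →
        f ∧ g , F.∧-closed f∈F g∈F ,
        ∧-greatest (trans (∧-monotonic (x∧y≤x f g) refl) f∧a≤b)
                   (trans (∧-monotonic (x∧y≤y f g) refl) g∧a≤d)
    }
    where module F = IsFilter F-filter

  -- Makes maximal filters prime: if `g ∧ a` and `h ∧ b` lie in an ideal, so does
  -- `(g ∧ h) ∧ (a ∨ b)`.
  ∧-∨-exchange : ∀ g h a b → (g ∧ h) ∧ (a ∨ b) ≤ (g ∧ a) ∨ (h ∧ b)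
  ∧-∨-exchange g h a b = trans (reflexive (∧-distribˡ-∨ (g ∧ h) a b))
    (∨-monotonic (∧-monotonic (x∧y≤x g h) refl) (∧-monotonic (x∧y≤y g h) refl))

  maximal-filter : ∀ {p q} {F : Pred Carrier p} {I : Pred Carrier q} →
    Filter F → Ideal I → ¬ (F ≬ I) →
    ∃ λ (x : PrimeFilter A) → F ⊆ filter x × ¬ (filter x ≬ I) ×
      (∀ {a} → a ∉ filter x → ∃ λ g → g ∈ filter x × g ∧ a ∈ I)
  maximal-filter {F = F} {I} F-filter I-ideal F#I = x , M⊇ ∘ resized⁺ em F , M#I , witness
    where
    module I = IsFilter I-ideal

    Avoiding : Pred (Pred Carrier (c ⊔ ℓ₁ ⊔ ℓ₂)) _
    Avoiding G = Filter G × ¬ (G ≬ I)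

    zorn-M = zorn em ac Avoiding
      (λ 𝒞 𝒞⊆ 𝒞≢∅ chain M M≐⋃ →
        filter-resp-≐ (≐-sym M≐⋃)
          (chain-⋃-isFilter 𝒞 (λ G∈𝒞 → proj₁ (𝒞⊆ G∈𝒞)) 𝒞≢∅ chain) ,
        λ (a , a∈M , a∈I) → let G , G∈𝒞 , a∈G = proj₁ M≐⋃ a∈M in
          proj₂ (𝒞⊆ G∈𝒞) (a , a∈G , a∈I))
      (resized em F)
      (resized-isFilter F-filter , λ (a , a∈F , a∈I) → F#I (a , resized⁻ em F a∈F , a∈I))

    M = proj₁ zorn-M
    M-filter = proj₁ (proj₁ (proj₂ zorn-M))
    M#I = proj₂ (proj₁ (proj₂ zorn-M))
    M⊇ = proj₁ (proj₂ (proj₂ zorn-M))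
    M-maximal = proj₂ (proj₂ (proj₂ zorn-M))
    module M = IsFilter M-filter

    witness : ∀ {a} → a ∉ M → ∃ λ g → g ∈ M × g ∧ a ∈ I
    -- Otherwise the filter generated by `M` and `a` avoids `I`, and maximality puts `a` in `M`.
    witness {a} a∉M = dne em λ ¬witness → a∉M
      (M-maximal
        (adjoin-isFilter M-filter a ,
         λ (b , (g , g∈M , g∧a≤b) , b∈I) → ¬witness (g , g∈M , I.upward b∈I g∧a≤b))
        (λ {b} b∈M → b , b∈M , x∧y≤x b a)
        (⊤ , M.⊤∈ , x∧y≤y ⊤ a))

    M-prime : ∀ {a b} → a ∨ b ∈ M → a ∈ M ⊎ b ∈ M
    M-prime {a} {b} a∨b∈M with em {P = a ∈ M} | em {P = b ∈ M}
    ... | yes a∈M | _       = inj₁ a∈M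
    ... | no  _   | yes b∈M = inj₂ b∈M
    ... | no a∉M  | no b∉M  =
      let g , g∈M , g∧a∈I = witness a∉M
          h , h∈M , h∧b∈I = witness b∉M
      in ⊥-elim (M#I (_ , M.∧-closed (M.∧-closed g∈M h∈M) a∨b∈M ,
                      I.upward (I.∧-closed g∧a∈I h∧b∈I) (∧-∨-exchange g h a b)))

    x : PrimeFilter A
    x = record
      { filter = M ; upward = M.upward ; ⊤∈ = M.⊤∈ ; ∧-closed = M.∧-closed
      ; ⊥∉ = λ ⊥∈M → M#I (⊥ , ⊥∈M , I.⊤∈) ; prime = M-prime }

  -- A prime filter of `opposite A` is a prime ideal of `A`.
  complement : PrimeFilter (opposite A) → PrimeFilter A
  complement x = record
    { filter   = ∁ (filter x)
    ; upward   = λ a∉x a≤b b∈x → a∉x (upward x b∈x a≤b)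
    ; ⊤∈       = ⊥∉ x
    ; ∧-closed = λ a∉x b∉x a∧b∈x → [ a∉x , b∉x ]′ (prime x a∧b∈x)
    ; ⊥∉       = λ ⊥∉x → ⊥∉x (⊤∈ x)
    ; prime    = λ {a} {b} a∨b∉x → case em {P = a ∈ filter x} of λ where
        (yes a∈x) → inj₂ λ b∈x → a∨b∉x (∧-closed x a∈x b∈x)
        (no a∉x)  → inj₁ a∉x
    }

-- The embedding `𝔰` and the topology it generates.

module _ (em : ∀ {ℓ} → ExcludedMiddle ℓ) (ac : ∀ {a b c d} → AxiomOfChoice a b c d)
  {c ℓ₁ ℓ₂} (A : BoundedDistributiveLattice c ℓ₁ ℓ₂) where

  open BoundedDistributiveLattice A
  open MeetSemilatticeProperties meetSemilattice using (∧-monotonic)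
  open PrimeFilter
  open PrimeFilterTheorem em ac A

  -- `maximal-filter` in the opposite lattice, with `F` and `I` exchanging roles, gives a maximal
  -- ideal around `I`; its complement is the prime filter sought.
  maximal-ideal : ∀ {p q} {F : Pred Carrier p} {I : Pred Carrier q} →
    Filter F → Ideal I → ¬ (F ≬ I) →
    ∃ λ (x : PrimeFilter A) → F ⊆ filter x × ¬ (filter x ≬ I) ×
      (∀ {a} → a ∈ filter x → ∃ λ g → g ∉ filter x × g ∨ a ∈ F)
  maximal-ideal F-filter I-ideal F#I =
    let x , I⊆x , x#F , witness =
          PrimeFilterTheorem.maximal-filter em ac (opposite A) I-ideal F-filter
            (λ (a , a∈I , a∈F) → F#I (a , a∈F , a∈I))
    in complement x
     , (λ {a} a∈F a∈x → x#F (a , a∈x , a∈F))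
     , (λ (a , a∉x , a∈I) → a∉x (I⊆x a∈I))
     , λ a∉x → let g , g∈x , g∨a∈F = witness a∉x in g , (λ g∉x → g∉x g∈x) , g∨a∈F

  -- If `a` is not below `b`, the principal filter of `a` misses the principal ideal of `b`, and a
  -- prime filter separates them.
  𝔰-reflects-≤ : ∀ {a b} → 𝔰 A a ⊆ 𝔰 A b → a ≤ b
  𝔰-reflects-≤ {a} {b} 𝔰a⊆𝔰b = dne em λ a≰b →
    let x , ≥a⊆x , x#≤b , _ = maximal-filter {F = a ≤_} {I = _≤ b}
          record { upward = trans ; ⊤∈ = maximum a ; ∧-closed = ∧-greatest }
          record { upward = flip trans ; ⊤∈ = minimum b ; ∧-closed = ∨-least }
          (λ (d , a≤d , d≤b) → a≰b (trans a≤d d≤b))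
    in x#≤b (b , 𝔰a⊆𝔰b {x} (≥a⊆x refl) , refl)

  𝔰-mono : ∀ {a b} → a ≤ b → 𝔰 A a ⊆ 𝔰 A b
  𝔰-mono a≤b {x} a∈x = upward x a∈x a≤b

  𝔰-cong : ∀ {a b} → a ≈ b → 𝔰 A a ≐ 𝔰 A b
  𝔰-cong a≈b =
    (λ {x} → 𝔰-mono (reflexive a≈b) {x}) , λ {x} → 𝔰-mono (reflexive (Eq.sym a≈b)) {x}

  𝔰-injective : ∀ {a b} → 𝔰 A a ≐ 𝔰 A b → a ≈ b
  𝔰-injective (𝔰a⊆𝔰b , 𝔰b⊆𝔰a) = 
    antisym (𝔰-reflects-≤ λ {x} → 𝔰a⊆𝔰b {x}) (𝔰-reflects-≤ λ {x} → 𝔰b⊆𝔰a {x})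

  -- Filters respect meets and prime filters split joins, so the meet of the first components and
  -- the join of the second describe the intersection.
  basic-open : (is : List (Carrier × Carrier)) → ∃₂ λ a b → ∀ x →
    All (λ (a , b) → x ∈ 𝔰 A a ∖ 𝔰 A b) is ⇔ x ∈ 𝔰 A a ∖ 𝔰 A b
  basic-open [] = ⊤ , ⊥ , λ x → mk⇔ (λ _ → ⊤∈ x , ⊥∉ x) (λ _ → [])
  basic-open ((a , b) ∷ is) with basic-open is
  ... | a′ , b′ , eqv = a ∧ a′ , b ∨ b′ , λ x → mk⇔
    (λ { ((a∈x , b∉x) ∷ all) →
      let a′∈x , b′∉x = Equivalence.to (eqv x) all
      in ∧-closed x a∈x a′∈x , λ b∨b′∈x → [ b∉x , b′∉x ]′ (prime x b∨b′∈x) })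
    λ (a∧a′∈x , b∨b′∉x) →
      (upward x a∧a′∈x (x∧y≤x a a′) , λ b∈x → b∨b′∉x (upward x b∈x (x≤x∨y b b′)))
      ∷ Equivalence.from (eqv x)
          (upward x a∧a′∈x (x∧y≤y a a′) , λ b′∈x → b∨b′∉x (upward x b′∈x (y≤x∨y b b′)))

  basic-neighbourhood : ∀ {w} {W : Pred (PrimeFilter A) w} → IsOpen A W → ∀ {x} → x ∈ W →
    ∃₂ λ a b → x ∈ 𝔰 A a ∖ 𝔰 A b × 𝔰 A a ∖ 𝔰 A b ⊆ W
  basic-neighbourhood W-open {x} x∈W =
    let is , all , ⋂⊆W = W-open x∈W
        a , b , eqv = basic-open is
    in a , b , Equivalence.to (eqv x) all , λ {y} y∈ → ⋂⊆W y (Equivalence.from (eqv y) y∈)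

  𝔰∖𝔰-open : ∀ a b → IsOpen A (𝔰 A a ∖ 𝔰 A b)
  𝔰∖𝔰-open a b x∈ = (a , b) ∷ [] , x∈ ∷ [] , λ { _ (y∈ ∷ []) → y∈ }

  open-resp-≐ : ∀ {v w} {V : Pred (PrimeFilter A) v} {W : Pred (PrimeFilter A) w} →
                V ≐ W → IsOpen A V → IsOpen A W
  open-resp-≐ (V⊆W , W⊆V) V-open x∈W =
    let is , all , ⋂⊆V = V-open (W⊆V x∈W) in is , all , λ y y∈ → V⊆W (⋂⊆V y y∈)

  𝔰-closed : ∀ a → IsClosed A (𝔰 A a)
  𝔰-closed a {x} a∉x =
    (⊤ , a) ∷ [] , (⊤∈ x , a∉x) ∷ [] , λ { _ ((_ , a∉y) ∷ []) → a∉y }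

  𝔰-open : ∀ a → IsOpen A (𝔰 A a)
  𝔰-open a {x} a∈x =
    (a , ⊥) ∷ [] , (a∈x , ⊥∉ x) ∷ [] , λ { _ ((a∈y , _) ∷ []) → a∈y }

  𝔰-clopenUpset : ∀ a → IsClopenUpset A (𝔰 A a)
  𝔰-clopenUpset a = ((λ {x} → 𝔰-open a {x}) , λ {x} → 𝔰-closed a {x}) , λ x⊆y → x⊆y

  clopenUpset-resp-≐ : ∀ {v w} {V : Pred (PrimeFilter A) v} {W : Pred (PrimeFilter A) w} →
                       V ≐ W → IsClopenUpset A V → IsClopenUpset A W
  clopenUpset-resp-≐ (V⊆W , W⊆V) ((V-open , V-closed) , V-upset) =
    ( open-resp-≐ (V⊆W , W⊆V) V-open
    , open-resp-≐ ((λ x∉V x∈W → x∉V (W⊆V x∈W)) , (λ x∉W x∈V → x∉W (V⊆W x∈V))) V-closed)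
    , λ x⊆y x∈W → V⊆W (V-upset x⊆y (W⊆V x∈W))

  -- Representation of clopen upsets.

  module _ {w} (V : Pred (PrimeFilter A) w) where

    -- A common element of the two is exactly an `a` with `V ≐ 𝔰 A a`.
    Inner Outer : Pred Carrier _
    Inner a = 𝔰 A a ⊆ V
    Outer a = V ⊆ 𝔰 A a

    inner-isIdeal : Ideal Inner
    inner-isIdeal = record
      { upward   = λ 𝔰a⊆V b≤a {x} b∈x → 𝔰a⊆V (upward x b∈x b≤a)
      ; ⊤∈       = λ {x} ⊥∈x → ⊥-elim (⊥∉ x ⊥∈x)
      ; ∧-closed = λ 𝔰a⊆V 𝔰b⊆V {x} a∨b∈x → case prime x a∨b∈x of λ where
          (inj₁ a∈x) → 𝔰a⊆V a∈x
          (inj₂ b∈x) → 𝔰b⊆V b∈x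
      }

    outer-isFilter : Filter Outer
    outer-isFilter = record
      { upward   = λ V⊆𝔰a a≤b {x} x∈V → upward x (V⊆𝔰a x∈V) a≤b
      ; ⊤∈       = λ {x} _ → ⊤∈ x
      ; ∧-closed = λ V⊆𝔰a V⊆𝔰b {x} x∈V → ∧-closed x (V⊆𝔰a x∈V) (V⊆𝔰b x∈V)
      }

    -- Otherwise `x` extends to a maximal `y` avoiding `Inner`, and `y ∈ V`. A basic neighbourhood
    -- `𝔰 A a ∖ 𝔰 A b` of `y` inside `V` and a `g ∈ y` with `g ∧ b` in `Inner` then put `g ∧ a` in
    -- both `y` and `Inner`.
    openUpset-covered : IsOpen A V → IsUpset A V → ∀ {x} → x ∈ V → filter x ≬ Inner
    openUpset-covered V-open V-upset {x} x∈V = dne em λ x#I →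
      let y , x⊆y , y#I , witness =
            maximal-filter (primeFilter-isFilter x) inner-isIdeal x#I
          a , b , (a∈y , b∉y) , 𝔰a∖𝔰b⊆V = basic-neighbourhood V-open (V-upset {x} {y} x⊆y x∈V)
          g , g∈y , 𝔰[g∧b]⊆V = witness b∉y
      in y#I (g ∧ a , ∧-closed y g∈y a∈y , λ {z} g∧a∈z →
           case em {P = b ∈ filter z} of λ where
             (yes b∈z) → 𝔰[g∧b]⊆V (∧-closed z (upward z g∧a∈z (x∧y≤x g a)) b∈z)
             (no  b∉z) → 𝔰a∖𝔰b⊆V (upward z g∧a∈z (x∧y≤y g a) , b∉z))

    -- A basic neighbourhood `𝔰 A a ∖ 𝔰 A b` of `z` missing `V` lets `b` replace `a` in
    -- `V ⊆ 𝔰 A (g ∨ a)`. Then `g ∨ b` is in `z` although neither `g` nor `b` is.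
    clopen-separated : IsClosed A V → ∀ {z} → z ∉ V → Outer ⊆ filter z →
      ¬ (∀ {a} → a ∈ filter z → ∃ λ g → g ∉ filter z × g ∨ a ∈ Outer)
    clopen-separated V-closed {z} z∉V O⊆z witness
      with basic-neighbourhood V-closed z∉V
    ... | a , b , (a∈z , b∉z) , 𝔰a∖𝔰b⊆∁V with witness a∈z
    ...   | g , g∉z , V⊆𝔰[g∨a] = [ g∉z , b∉z ]′ (prime z (O⊆z V⊆𝔰[g∨b]))
      where
      V⊆𝔰[g∨b] : V ⊆ 𝔰 A (g ∨ b)
      V⊆𝔰[g∨b] {u} u∈V with prime u (V⊆𝔰[g∨a] u∈V)
      ... | inj₁ g∈u = upward u g∈u (x≤x∨y g b)
      ... | inj₂ a∈u = upward u (dne em λ b∉u → 𝔰a∖𝔰b⊆∁V (a∈u , b∉u) u∈V) (y≤x∨y g b)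

    -- If `Outer` and `Inner` were disjoint, a prime filter `z` would separate them; it lies outside
    -- `V` by `openUpset-covered`, which `clopen-separated` forbids.
    clopenUpset⇒𝔰 : IsClopenUpset A V → ∃ λ a → V ≐ 𝔰 A a
    clopenUpset⇒𝔰 ((V-open , V-closed) , V-upset) = dne em {P = ∃ λ a → V ≐ 𝔰 A a} λ ¬𝔰 →
      let z , O⊆z , z#I , witness = maximal-ideal outer-isFilter inner-isIdeal
            (λ (a , V⊆𝔰a , 𝔰a⊆V) → ¬𝔰 (a , V⊆𝔰a , 𝔰a⊆V))
      in clopen-separated V-closed {z} (λ z∈V → z#I (openUpset-covered V-open V-upset z∈V))
           O⊆z witness

  -- Closures and distributive joins.

  ⊆cl : ∀ {u} {U : Pred (PrimeFilter A) u} → U ⊆ cl A U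
  ⊆cl {x = x} x∈U W _ x∈W = x , x∈W , x∈U

  cl⊆𝔰 : ∀ {u} {U : Pred (PrimeFilter A) u} {a} → U ⊆ 𝔰 A a → cl A U ⊆ 𝔰 A a
  cl⊆𝔰 {a = a} U⊆𝔰a x∈cl = dne em λ a∉x →
    let y , a∉y , y∈U = x∈cl (∁ (𝔰 A a)) (λ {z} → 𝔰-closed a {z}) a∉x in a∉y (U⊆𝔰a y∈U)

  cl≐𝔰 : ∀ {p u} {S : Pred Carrier p} {U : Pred (PrimeFilter A) u} {j} →
    U ≐ (λ x → S ≬ filter x) → IsJoin A S j → (∀ a → IsJoin A (_∧ˢ_ A a S) (a ∧ j)) →
    cl A U ≐ 𝔰 A j
  cl≐𝔰 {S = S} {U} {j} (U⊆ , ⊆U) S-join distributive = cl⊆𝔰 U⊆𝔰j , 𝔰j⊆cl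
    where
    U⊆𝔰j : U ⊆ 𝔰 A j
    U⊆𝔰j {x} x∈U = let s , s∈S , s∈x = U⊆ x∈U in upward x s∈x (IsJoin.upper S-join s∈S)

    𝔰j⊆cl : 𝔰 A j ⊆ cl A U
    𝔰j⊆cl {x} j∈x W W-open x∈W with basic-neighbourhood W-open x∈W
    ... | a , b , (a∈x , b∉x) , 𝔰a∖𝔰b⊆W = dne em λ W#U →
      let a∧s≤b : ∀ {s} → s ∈ S → a ∧ s ≤ b
          a∧s≤b {s} s∈S = 𝔰-reflects-≤ λ {y} a∧s∈y → dne em λ b∉y →
            W#U (y , 𝔰a∖𝔰b⊆W (upward y a∧s∈y (x∧y≤x a s) , b∉y)
                   , ⊆U (s , s∈S , upward y a∧s∈y (x∧y≤y a s)))
          a∧j≤b = IsJoin.least (distributive a)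
                    λ (s , s∈S , d≈a∧s) → trans (reflexive d≈a∧s) (a∧s≤b s∈S)
      in b∉x (upward x (∧-closed x a∈x j∈x) a∧j≤b)

  cl≐𝔰⇒isJoin : ∀ {p u} {S : Pred Carrier p} {U : Pred (PrimeFilter A) u} {j} →
    U ≐ (λ x → S ≬ filter x) → cl A U ≐ 𝔰 A j →
    IsJoin A S j × (∀ a → IsJoin A (_∧ˢ_ A a S) (a ∧ j))
  cl≐𝔰⇒isJoin {S = S} {U} {j} (U⊆ , ⊆U) (cl⊆𝔰j , 𝔰j⊆cl) =
    record { upper = upper ; least = least } , λ a → record
      { upper = λ (s , s∈S , d≈a∧s) →
          trans (reflexive d≈a∧s) (∧-monotonic refl (upper s∈S))
      -- A point of `𝔰 A (a ∧ j)` that omits the bound `b` lies in `cl A U` and in the open set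
      -- `𝔰 A a ∖ 𝔰 A b`, which therefore meets `𝔰 A s` for some `s ∈ S`.
      ; least = λ a∧S≤b → 𝔰-reflects-≤ λ {x} a∧j∈x → dne em λ b∉x →
          let y , (a∈y , b∉y) , y∈U = 𝔰j⊆cl {x} (upward x a∧j∈x (x∧y≤y a j)) _
                (λ {z} → 𝔰∖𝔰-open a _ {z}) (upward x a∧j∈x (x∧y≤x a j) , b∉x)
              s , s∈S , s∈y = U⊆ y∈U
          in b∉y (upward y (∧-closed y a∈y s∈y) (a∧S≤b (s , s∈S , Eq.refl)))
      }
    where
    upper : ∀ {s} → s ∈ S → s ≤ j
    upper s∈S = 𝔰-reflects-≤ λ {x} s∈x → cl⊆𝔰j (⊆cl {x = x} (⊆U (_ , s∈S , s∈x)))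

    least : ∀ {b} → (∀ {s} → s ∈ S → s ≤ b) → j ≤ b
    least {b} S≤b = 𝔰-reflects-≤ λ {x} j∈x → cl⊆𝔰
      (λ {y} y∈U → let s , s∈S , s∈y = U⊆ y∈U in upward y s∈y (S≤b s∈S))
      (𝔰j⊆cl {x} j∈x)

  -- Small subsets of the lattice and small families of clopen upsets.

  module _ {k} (K : Set k) where

    -- `𝔰` embeds the elements that represent members of `𝒰` into `𝒰`, so there are fewer than κ of
    -- them; every member is represented, so together they cover `U`.
    κFrame⇒cl-clopenUpset : IsκFrame A K → (U : Pred (PrimeFilter A) (suc (c ⊔ ℓ₁ ⊔ ℓ₂))) →
      IsκClopenUpset A K U → IsClopenUpset A (cl A U)
    κFrame⇒cl-clopenUpset frame U (𝒰 , 𝒰-resp , 𝒰≺K , 𝒰-clopenUpset , U⊆⋃𝒰 , ⋃𝒰⊆U) =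
      let j , S-join , distributive = frame S S-resp (≺-trans-injection S↣𝒰 𝒰≺K)
      in clopenUpset-resp-≐ (≐-sym (cl≐𝔰 U≐ S-join distributive)) (𝔰-clopenUpset j)
      where
      𝔰∈𝒰 : Pred Carrier _
      𝔰∈𝒰 a = 𝔰 A a ∈ 𝒰

      S : Pred Carrier (c ⊔ ℓ₁ ⊔ ℓ₂)
      S = resized em 𝔰∈𝒰

      S-resp : S Respects _≈_
      S-resp a≈b a∈S = resized⁺ em 𝔰∈𝒰 (𝒰-resp (𝔰-cong a≈b) (resized⁻ em 𝔰∈𝒰 a∈S))

      S↣𝒰 : Injection (subset setoid S) (subset (≐-setoid (PrimeFilter A) _) 𝒰)
      S↣𝒰 = record
        { to        = λ (a , a∈S) → 𝔰 A a , resized⁻ em 𝔰∈𝒰 a∈S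
        ; cong      = 𝔰-cong
        ; injective = 𝔰-injective
        }

      U≐ : U ≐ (λ x → S ≬ filter x)
      U≐ = (λ x∈U →
             let V , V∈𝒰 , x∈V = U⊆⋃𝒰 x∈U
                 a , V≐𝔰a = clopenUpset⇒𝔰 V (𝒰-clopenUpset V V∈𝒰)
             in a , resized⁺ em 𝔰∈𝒰 (𝒰-resp V≐𝔰a V∈𝒰) , proj₁ V≐𝔰a x∈V)
         , λ (a , a∈S , a∈x) → ⋃𝒰⊆U (𝔰 A a , resized⁻ em 𝔰∈𝒰 a∈S , a∈x)

    cl-clopenUpset⇒κFrame : ((U : Pred (PrimeFilter A) (suc (c ⊔ ℓ₁ ⊔ ℓ₂))) →
      IsκClopenUpset A K U → IsClopenUpset A (cl A U)) → IsκFrame A K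
    cl-clopenUpset⇒κFrame cl-clopenUpset S S-resp S≺K =
      let j , cl≐𝔰j = clopenUpset⇒𝔰 (cl A (⋃ˢ 𝒰)) (cl-clopenUpset (⋃ˢ 𝒰)
            ( 𝒰 , 𝒰-resp , ≺-trans-injection 𝒰↣S S≺K
            , (λ V (s , _ , V≐𝔰s) → clopenUpset-resp-≐ (≐-sym V≐𝔰s) (𝔰-clopenUpset s))
            , id , id))
      in j , cl≐𝔰⇒isJoin ⋃𝒰≐ cl≐𝔰j
      where
      𝒰 : Pred (Pred (PrimeFilter A) (c ⊔ ℓ₁ ⊔ ℓ₂)) (suc (c ⊔ ℓ₁ ⊔ ℓ₂))
      𝒰 V = ∃ λ s → s ∈ S × V ≐ 𝔰 A s

      𝒰-resp : 𝒰 Respects _≐_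
      𝒰-resp V≐W (s , s∈S , V≐𝔰s) = s , s∈S , ≐-trans (≐-sym V≐W) V≐𝔰s

      -- The element representing `V` is unique up to `≈`, so sending `V` to it respects equality
      -- and bounds the size of `𝒰`.
      𝒰↣S : Injection (subset (≐-setoid (PrimeFilter A) _) 𝒰) (subset setoid S)
      𝒰↣S = record
        { to        = λ (V , s , s∈S , _) → s , s∈S
        ; cong      = λ {(_ , _ , _ , V≐𝔰s) (_ , _ , _ , W≐𝔰t)} V≐W →
            𝔰-injective (≐-trans (≐-sym V≐𝔰s) (≐-trans V≐W W≐𝔰t))
        ; injective = λ {(_ , _ , _ , V≐𝔰s) (_ , _ , _ , W≐𝔰t)} s≈t →
            ≐-trans V≐𝔰s (≐-trans (𝔰-cong s≈t) (≐-sym W≐𝔰t))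
        }

      ⋃𝒰≐ : ⋃ˢ 𝒰 ≐ (λ x → S ≬ filter x)
      ⋃𝒰≐ = (λ (V , (s , s∈S , V⊆𝔰s , _) , x∈V) → s , s∈S , V⊆𝔰s x∈V)
          , λ (s , s∈S , s∈x) → 𝔰 A s , (s , s∈S , id , id) , s∈x

theorem5p18 : (∀ {ℓ} → ExcludedMiddle ℓ) →
    (∀ {a b c d} → AxiomOfChoice a b c d) →
    ∀ {c ℓ₁ ℓ₂ k} (A : BoundedDistributiveLattice c ℓ₁ ℓ₂) (K : Set k) →
    IsRegularCardinal K →
    IsκFrame A K ⇔ ((U : Pred (PrimeFilter A) (suc (c ⊔ ℓ₁ ⊔ ℓ₂))) → IsκClopenUpset A K U → IsClopenUpset A (cl A U))
theorem5p18 em ac A K _ =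
  mk⇔ (κFrame⇒cl-clopenUpset em ac A K) (cl-clopenUpset⇒κFrame em ac A K)
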